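{- Let $(P,\varphi)$ be a finite closure space of semilattice type. Then the lattice $\operatorname{Reg}(P,\varphi)$ is semidistributive if and only if it is a bounded homomorphic image of a free lattice.
   Context: A closure operator on a set $P$ is a map $\varphi$ on subsets of $P$ that is extensive, idempotent, isotone with $\varphi(\varnothing)=\varnothing$ (on a finite set it is automatically algebraic). A minimal covering of $p\in P$ is a set $\boldsymbol{x}$, minimal under inclusion, with $p\in\varphi(\boldsymbol{x})$. $(P,\varphi)$ has semilattice type if there is a partial order on $P$ such that for every $p$ and every minimal covering $\boldsymbol{x}$ of $p$, $p$ is the join (least upper bound) of $\boldsymbol{x}$ in that poset. Interior: $\check\varphi(\boldsymbol{x})=P\setminus\varphi(P\setminus\boldsymbol{x})$; regular closed means $\boldsymbol{x}=\varphi\check\varphi(\boldsymbol{x})$; $\operatorname{Reg}(P,\varphi)$ is the lattice of regular closed sets under inclusion (joins $\varphi(\bigcup)$, meets $\varphi\check\varphi(\bigcap)$). A lattice is semidistributive if $x\vee z=y\vee z$ implies $x\vee z=(x\wedge y)\vee z$ and dually $x\wedge z=y\wedge z$ implies $x\wedge z=(x\vee y)\wedge z$. A lattice $L$ is a bounded homomorphic image of a free lattice if there is a free lattice $F$ and a surjective lattice homomorphism $f\colon F\to L$ such that each $f^{ -1}\{x\}$ has a least and a largest element. -}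

module Defs where

open import Level using (0ℓ)
open import Data.Nat using (ℕ)
open import Data.Fin using (Fin)
open import Data.Fin.Subset using (Subset; _∈_; _⊆_; _∪_; _∩_; ∁) renaming (⊥ to ∅)
open import Data.Product using (Σ; Σ-syntax; ∃; ∃-syntax; _×_; _,_; proj₁)
open import Relation.Binary.PropositionalEquality using (_≡_)
open import Relation.Binary.Structures using (IsPartialOrder)

-- Free lattice on a set X: lattice terms modulo the least congruence
-- containing the lattice axioms (elements = terms, equality = _≈F_).

infixr 6 _∨ₜ_
infixr 7 _∧ₜ_
data Term (X : Set) : Set where
  var  : X → Term X
  _∨ₜ_ : Term X → Term X → Term X
  _∧ₜ_ : Term X → Term X → Term X

infix 4 _≈F_
data _≈F_ {X : Set} : Term X → Term X → Set where
  ≈-refl   : ∀ {a} → a ≈F a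
  ≈-sym    : ∀ {a b} → a ≈F b → b ≈F a
  ≈-trans  : ∀ {a b c} → a ≈F b → b ≈F c → a ≈F c
  ∨-cong   : ∀ {a b c d} → a ≈F b → c ≈F d → (a ∨ₜ c) ≈F (b ∨ₜ d)
  ∧-cong   : ∀ {a b c d} → a ≈F b → c ≈F d → (a ∧ₜ c) ≈F (b ∧ₜ d)
  ∨-comm   : ∀ {a b} → (a ∨ₜ b) ≈F (b ∨ₜ a)
  ∧-comm   : ∀ {a b} → (a ∧ₜ b) ≈F (b ∧ₜ a)
  ∨-assoc  : ∀ {a b c} → ((a ∨ₜ b) ∨ₜ c) ≈F (a ∨ₜ (b ∨ₜ c))
  ∧-assoc  : ∀ {a b c} → ((a ∧ₜ b) ∧ₜ c) ≈F (a ∧ₜ (b ∧ₜ c))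
  ∨-idem   : ∀ {a} → (a ∨ₜ a) ≈F a
  ∧-idem   : ∀ {a} → (a ∧ₜ a) ≈F a
  ∨-absorb : ∀ {a b} → (a ∨ₜ (a ∧ₜ b)) ≈F a
  ∧-absorb : ∀ {a b} → (a ∧ₜ (a ∨ₜ b)) ≈F a

infix 4 _≤F_
_≤F_ : {X : Set} → Term X → Term X → Set
a ≤F b = (a ∧ₜ b) ≈F a

record ClosureOperator (n : ℕ) : Set where
  field
    φ          : Subset n → Subset n
    extensive  : ∀ x → x ⊆ φ x
    idempotent : ∀ x → φ (φ x) ≡ φ x
    isotone    : ∀ x y → x ⊆ y → φ x ⊆ φ y
    φ-empty    : φ ∅ ≡ ∅

module _ {n : ℕ} (C : ClosureOperator n) where
  open ClosureOperator C

  interior : Subset n → Subset n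
  interior x = ∁ (φ (∁ x))

  IsRegularClosed : Subset n → Set
  IsRegularClosed x = x ≡ φ (interior x)

  MinimalCovering : Fin n → Subset n → Set
  MinimalCovering p x = (p ∈ φ x) × (∀ y → y ⊆ x → p ∈ φ y → y ≡ x)

  IsJoinIn : (Fin n → Fin n → Set) → Fin n → Subset n → Set
  IsJoinIn _≤_ p x = (∀ q → q ∈ x → q ≤ p) × (∀ r → (∀ q → q ∈ x → q ≤ r) → p ≤ r)

  SemilatticeType : Set₁
  SemilatticeType =
    Σ (Fin n → Fin n → Set) λ _≤_ → IsPartialOrder _≡_ _≤_ ×
      (∀ p x → MinimalCovering p x → IsJoinIn _≤_ p x)

  -- the lattice Reg(P, φ): its elements are the regular closed subsets;
  -- join and meet are computed on underlying subsets
  _∨R_ : Subset n → Subset n → Subset n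
  x ∨R y = φ (x ∪ y)

  _∧R_ : Subset n → Subset n → Subset n
  x ∧R y = φ (interior (x ∩ y))

  RegSemidistributive : Set
  RegSemidistributive =
    (∀ x y z → IsRegularClosed x → IsRegularClosed y → IsRegularClosed z →
       x ∨R z ≡ y ∨R z → x ∨R z ≡ (x ∧R y) ∨R z) ×
    (∀ x y z → IsRegularClosed x → IsRegularClosed y → IsRegularClosed z →
       x ∧R z ≡ y ∧R z → x ∧R z ≡ (x ∨R y) ∧R z)

  RegBoundedHomImageOfFree : Set₁
  RegBoundedHomImageOfFree =
    Σ Set λ X → Σ (Term X → Subset n) λ f →
      (∀ t → IsRegularClosed (f t)) ×
      (∀ s t → s ≈F t → f s ≡ f t) ×
      (∀ s t → f (s ∨ₜ t) ≡ f s ∨R f t) ×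
      (∀ s t → f (s ∧ₜ t) ≡ f s ∧R f t) ×
      (∀ x → IsRegularClosed x → Σ (Term X) λ t → f t ≡ x) ×
      (∀ x → IsRegularClosed x →
         Σ (Term X) λ t → (f t ≡ x) × (∀ s → f s ≡ x → t ≤F s)) ×
      (∀ x → IsRegularClosed x →
         Σ (Term X) λ t → (f t ≡ x) × (∀ s → f s ≡ x → s ≤F t))

{-# OPTIONS --safe #-}

-- Bounded ⇒ semidistributive: free lattices are semidistributive by Whitman's condition,
-- and least (greatest) preimages carry joins (meets) of the lattice into the free lattice.
--
-- Semidistributive ⇒ bounded: Let a be a minimal regular closed set containing p; then
-- every element of a lies below p in the semilattice order. If a ≤ x ∨ y but a ≰ x and
-- a ≰ y, join-semidistributivity makes a lie below the join of regular closed sets around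
-- points strictly below p that are contained in x or in y. So the least term above a is,
-- by well-founded recursion on p, a meet of generators above a and of joins of terms
-- already obtained for points strictly below p. Greatest terms follow by orthocomplementation.
module Submission where

open import Defs
open import Data.Nat using (ℕ; zero; suc)
open import Function.Bundles using (_⇔_; mk⇔)
open import Data.Bool using (Bool; true; false; not)
import Data.Bool.Properties as Bool
open import Data.Fin using (Fin; _≟_)
open import Data.Fin.Induction using (po-wellFounded)
open import Data.Fin.Properties using (sequence; all?)
open import Data.Fin.Subset using (_⊂_; Subset; inside; outside; _∈_; _⊆_; _∪_; _∩_; ∁; ⊤) renaming (⊥ to ∅)
open import Data.Fin.Subset.Induction using (⊂-wellFounded)
open import Data.Fin.Subset.Properties
open import Data.List using (List; []; _∷_; allFin)
open import Data.List.Membership.Propositional using () renaming (_∈_ to _∈ˡ_)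
open import Data.List.Membership.Propositional.Properties using (∈-allFin)
open import Data.List.Relation.Unary.Any using (here; there)
open import Data.Product using (Σ-syntax; _×_; _,_; proj₁; proj₂; map₁)
open import Data.Sum using (_⊎_; inj₁; inj₂; [_,_]′) renaming (map₁ to map-left)
open import Data.Vec using (tabulate; []; _∷_)
open import Data.Vec.Properties using (lookup⇒[]=; []=⇒lookup; lookup∘tabulate; ≡-dec)
open import Effect.Monad using (RawMonad)
open import Function using (_∘_; id)
open import Induction.WellFounded using (Acc; acc)
open import Relation.Binary.PropositionalEquality
  using (_≡_; _≢_; refl; sym; trans; cong; cong₂; subst; subst₂; isEquivalence)
open import Relation.Binary.Structures using (IsPartialOrder)
open import Relation.Nullary using (¬_; Dec; yes; no; does; contradiction)
open import Relation.Nullary.Decidable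
  using (¬?; _×-dec_; _→-dec_; decidable-stable; ¬¬-excluded-middle; dec-true)
open import Relation.Nullary.Negation using (¬¬-Monad)

-- Free lattices: Whitman's order

infix 4 _⊢_
-- A cut-free calculus: without a transitivity rule, a derivation of `a ∧ₜ b ⊢ c ∨ₜ d` ends in one
-- of four rules, which is Whitman's condition.
data _⊢_ {X : Set} : Term X → Term X → Set where
  ⊢-var    : ∀ {x} → var x ⊢ var x
  ∨-left   : ∀ {a b c} → a ⊢ c → b ⊢ c → a ∨ₜ b ⊢ c
  ∨-right₁ : ∀ {a b c} → c ⊢ a → c ⊢ a ∨ₜ b
  ∨-right₂ : ∀ {a b c} → c ⊢ b → c ⊢ a ∨ₜ b
  ∧-left₁  : ∀ {a b c} → a ⊢ c → a ∧ₜ b ⊢ c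
  ∧-left₂  : ∀ {a b c} → b ⊢ c → a ∧ₜ b ⊢ c
  ∧-right  : ∀ {a b c} → c ⊢ a → c ⊢ b → c ⊢ a ∧ₜ b

module _ {X : Set} where

  ⊢-refl : (a : Term X) → a ⊢ a
  ⊢-refl (var x)  = ⊢-var
  ⊢-refl (a ∨ₜ b) = ∨-left (∨-right₁ (⊢-refl a)) (∨-right₂ (⊢-refl b))
  ⊢-refl (a ∧ₜ b) = ∧-right (∧-left₁ (⊢-refl a)) (∧-left₂ (⊢-refl b))

  -- Cut elimination: left rules of the first derivation and right rules of the second move
  -- outwards, and the remaining matching pairs reduce to smaller cuts.
  ⊢-trans : {a b c : Term X} → a ⊢ b → b ⊢ c → a ⊢ c
  ⊢-trans ⊢-var        q              = q
  ⊢-trans (∨-left p r) q              = ∨-left (⊢-trans p q) (⊢-trans r q)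
  ⊢-trans (∧-left₁ p)  q              = ∧-left₁ (⊢-trans p q)
  ⊢-trans (∧-left₂ p)  q              = ∧-left₂ (⊢-trans p q)
  ⊢-trans p            (∨-right₁ q)   = ∨-right₁ (⊢-trans p q)
  ⊢-trans p            (∨-right₂ q)   = ∨-right₂ (⊢-trans p q)
  ⊢-trans p            (∧-right q r)  = ∧-right (⊢-trans p q) (⊢-trans p r)
  ⊢-trans (∨-right₁ p) (∨-left q r)   = ⊢-trans p q
  ⊢-trans (∨-right₂ p) (∨-left q r)   = ⊢-trans p r
  ⊢-trans (∧-right p r) (∧-left₁ q)   = ⊢-trans p q
  ⊢-trans (∧-right p r) (∧-left₂ q)   = ⊢-trans r q

  ≈F⇒⊢ : {a b : Term X} → a ≈F b → (a ⊢ b) × (b ⊢ a)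
  ≈F⇒⊢ (≈-refl {a}) = ⊢-refl a , ⊢-refl a
  ≈F⇒⊢ (≈-sym e) = let p , q = ≈F⇒⊢ e in q , p
  ≈F⇒⊢ (≈-trans e e′) =
    let p , q = ≈F⇒⊢ e ; p′ , q′ = ≈F⇒⊢ e′ in ⊢-trans p p′ , ⊢-trans q′ q
  ≈F⇒⊢ (∨-cong e e′) =
    let p , q = ≈F⇒⊢ e ; p′ , q′ = ≈F⇒⊢ e′
    in ∨-left (∨-right₁ p) (∨-right₂ p′) , ∨-left (∨-right₁ q) (∨-right₂ q′)
  ≈F⇒⊢ (∧-cong e e′) =
    let p , q = ≈F⇒⊢ e ; p′ , q′ = ≈F⇒⊢ e′
    in ∧-right (∧-left₁ p) (∧-left₂ p′) , ∧-right (∧-left₁ q) (∧-left₂ q′)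
  ≈F⇒⊢ (∨-comm {a} {b}) = comm a b , comm b a
    where comm = λ a b → ∨-left (∨-right₂ (⊢-refl a)) (∨-right₁ (⊢-refl b))
  ≈F⇒⊢ (∧-comm {a} {b}) = comm a b , comm b a
    where comm = λ a b → ∧-right (∧-left₂ (⊢-refl b)) (∧-left₁ (⊢-refl a))
  ≈F⇒⊢ (∨-assoc {a} {b} {c}) =
    ∨-left (∨-left (∨-right₁ (⊢-refl a)) (∨-right₂ (∨-right₁ (⊢-refl b))))
           (∨-right₂ (∨-right₂ (⊢-refl c))) ,
    ∨-left (∨-right₁ (∨-right₁ (⊢-refl a)))
           (∨-left (∨-right₁ (∨-right₂ (⊢-refl b))) (∨-right₂ (⊢-refl c)))
  ≈F⇒⊢ (∧-assoc {a} {b} {c}) =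
    ∧-right (∧-left₁ (∧-left₁ (⊢-refl a)))
            (∧-right (∧-left₁ (∧-left₂ (⊢-refl b))) (∧-left₂ (⊢-refl c))) ,
    ∧-right (∧-right (∧-left₁ (⊢-refl a)) (∧-left₂ (∧-left₁ (⊢-refl b))))
            (∧-left₂ (∧-left₂ (⊢-refl c)))
  ≈F⇒⊢ (∨-idem {a}) = ∨-left (⊢-refl a) (⊢-refl a) , ∨-right₁ (⊢-refl a)
  ≈F⇒⊢ (∧-idem {a}) = ∧-left₁ (⊢-refl a) , ∧-right (⊢-refl a) (⊢-refl a)
  ≈F⇒⊢ (∨-absorb {a}) = ∨-left (⊢-refl a) (∧-left₁ (⊢-refl a)) , ∨-right₁ (⊢-refl a)
  ≈F⇒⊢ (∧-absorb {a}) = ∧-left₁ (⊢-refl a) , ∧-right (⊢-refl a) (∨-right₁ (⊢-refl a))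

  ≤F⇒⊢ : {a b : Term X} → a ≤F b → a ⊢ b
  ≤F⇒⊢ {b = b} e = ⊢-trans (proj₂ (≈F⇒⊢ e)) (∧-left₂ (⊢-refl b))

  ≤F⇒∨≈ : {a b : Term X} → a ≤F b → (a ∨ₜ b) ≈F b
  ≤F⇒∨≈ e = ≈-trans (∨-cong (≈-trans (≈-sym e) ∧-comm) ≈-refl) (≈-trans ∨-comm ∨-absorb)

  ∨≈⇒≤F : {a b : Term X} → (a ∨ₜ b) ≈F b → a ≤F b
  ∨≈⇒≤F e = ≈-trans (∧-cong ≈-refl (≈-sym e)) ∧-absorb

  ⊢⇒≤F : {a b : Term X} → a ⊢ b → a ≤F b
  ⊢⇒≤F ⊢-var = ∧-idem
  ⊢⇒≤F (∨-left p q) =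
    ∨≈⇒≤F (≈-trans ∨-assoc (≈-trans (∨-cong ≈-refl (≤F⇒∨≈ (⊢⇒≤F q))) (≤F⇒∨≈ (⊢⇒≤F p))))
  ⊢⇒≤F (∨-right₁ p) =
    ∨≈⇒≤F (≈-trans (≈-sym ∨-assoc) (∨-cong (≤F⇒∨≈ (⊢⇒≤F p)) ≈-refl))
  ⊢⇒≤F (∨-right₂ p) =
    ∨≈⇒≤F (≈-trans (∨-cong ≈-refl ∨-comm) (≈-trans (≈-sym ∨-assoc)
      (≈-trans (∨-cong (≤F⇒∨≈ (⊢⇒≤F p)) ≈-refl) ∨-comm)))
  ⊢⇒≤F (∧-left₁ p) =
    ≈-trans (∧-cong ∧-comm ≈-refl) (≈-trans ∧-assoc (≈-trans (∧-cong ≈-refl (⊢⇒≤F p)) ∧-comm))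
  ⊢⇒≤F (∧-left₂ p) = ≈-trans ∧-assoc (∧-cong ≈-refl (⊢⇒≤F p))
  ⊢⇒≤F (∧-right p q) = ≈-trans (≈-sym ∧-assoc) (≈-trans (∧-cong (⊢⇒≤F p) ≈-refl) (⊢⇒≤F q))

  ⊢-antisym : {a b : Term X} → a ⊢ b → b ⊢ a → a ≈F b
  ⊢-antisym p q = ≈-trans (≈-sym (⊢⇒≤F p)) (≈-trans ∧-comm (⊢⇒≤F q))

  -- Induction on a term below both joins. By Whitman's condition a meet of this kind lies below
  -- `z`, or below both `x` and `y`, or has a factor below one join; `e` or `e′` then puts that
  -- factor below the other join as well.
  ⊢-semidistributive-∨ : {x y z : Term X} → x ∨ₜ z ⊢ y ∨ₜ z → y ∨ₜ z ⊢ x ∨ₜ z →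
    x ∨ₜ z ⊢ (x ∧ₜ y) ∨ₜ z
  ⊢-semidistributive-∨ {x} {y} {z} e e′ = below (x ∨ₜ z) (⊢-refl _) e
    where
    below : ∀ s → s ⊢ x ∨ₜ z → s ⊢ y ∨ₜ z → s ⊢ (x ∧ₜ y) ∨ₜ z
    below (a ∨ₜ b) p q =
      ∨-left (below a (⊢-trans a⊢ p) (⊢-trans a⊢ q)) (below b (⊢-trans b⊢ p) (⊢-trans b⊢ q))
      where
      a⊢ = ∨-right₁ (⊢-refl a)
      b⊢ = ∨-right₂ (⊢-refl b)
    below (a ∧ₜ b) (∧-left₁ p) _ = ∧-left₁ (below a p (⊢-trans p e))
    below (a ∧ₜ b) (∧-left₂ p) _ = ∧-left₂ (below b p (⊢-trans p e))
    below (a ∧ₜ b) (∨-right₂ p) _ = ∨-right₂ p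
    below (a ∧ₜ b) _ (∧-left₁ q) = ∧-left₁ (below a (⊢-trans q e′) q)
    below (a ∧ₜ b) _ (∧-left₂ q) = ∧-left₂ (below b (⊢-trans q e′) q)
    below (a ∧ₜ b) _ (∨-right₂ q) = ∨-right₂ q
    below (a ∧ₜ b) (∨-right₁ p) (∨-right₁ q) = ∨-right₁ (∧-right p q)
    below (var _) (∨-right₂ p) _ = ∨-right₂ p
    below (var _) _ (∨-right₂ q) = ∨-right₂ q
    below (var _) (∨-right₁ p) (∨-right₁ q) = ∨-right₁ (∧-right p q)

  -- The relabelling `i` is the identity when semidistributivity is dualized; later it exchanges
  -- each generator with its complement, so that `dual` mirrors orthocomplementation.
  module Dual (i : X → X) where

    dual : Term X → Term X
    dual (var x)  = var (i x)
    dual (a ∨ₜ b) = dual a ∧ₜ dual b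
    dual (a ∧ₜ b) = dual a ∨ₜ dual b

    dual-⊢ : {a b : Term X} → a ⊢ b → dual b ⊢ dual a
    dual-⊢ ⊢-var         = ⊢-var
    dual-⊢ (∨-left p q)  = ∧-right (dual-⊢ p) (dual-⊢ q)
    dual-⊢ (∨-right₁ p)  = ∧-left₁ (dual-⊢ p)
    dual-⊢ (∨-right₂ p)  = ∧-left₂ (dual-⊢ p)
    dual-⊢ (∧-left₁ p)   = ∨-right₁ (dual-⊢ p)
    dual-⊢ (∧-left₂ p)   = ∨-right₂ (dual-⊢ p)
    dual-⊢ (∧-right p q) = ∨-left (dual-⊢ p) (dual-⊢ q)

    dual-involutive : (∀ x → i (i x) ≡ x) → ∀ a → dual (dual a) ≡ a
    dual-involutive h (var x)  = cong var (h x)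
    dual-involutive h (a ∨ₜ b) = cong₂ _∨ₜ_ (dual-involutive h a) (dual-involutive h b)
    dual-involutive h (a ∧ₜ b) = cong₂ _∧ₜ_ (dual-involutive h a) (dual-involutive h b)

  ⊢-semidistributive-∧ : {x y z : Term X} → x ∧ₜ z ⊢ y ∧ₜ z → y ∧ₜ z ⊢ x ∧ₜ z →
    (x ∨ₜ y) ∧ₜ z ⊢ x ∧ₜ z
  ⊢-semidistributive-∧ {x} {y} {z} e e′ =
    subst₂ _⊢_ (dual-involutive (λ _ → refl) ((x ∨ₜ y) ∧ₜ z)) (dual-involutive (λ _ → refl) (x ∧ₜ z))
      (dual-⊢ (⊢-semidistributive-∨ (dual-⊢ e′) (dual-⊢ e)))
    where open Dual id

-- Bounded images of free lattices are semidistributive.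

bounded⇒semidistributive : ∀ {n} (C : ClosureOperator n) →
  RegBoundedHomImageOfFree C → RegSemidistributive C
bounded⇒semidistributive C (X , f , _ , f-cong , f-∨ , f-∧ , _ , least , greatest) = sd∨ , sd∧
  where
  _∨_ = _∨R_ C
  _∧_ = _∧R_ C

  Least Greatest : Term X → Set
  Least a    = ∀ s → f s ≡ f a → a ≤F s
  Greatest a = ∀ s → f s ≡ f a → s ≤F a

  -- By absorption `a ∧ₜ w` has the same image as `a`, so leastness puts `a` below it.
  least-⊢ : ∀ {a b w} → Least a → f w ≡ f (a ∨ₜ b) → a ⊢ w
  least-⊢ {a} {b} {w} a-least e = ⊢-trans (≤F⇒⊢ (a-least (a ∧ₜ w) (trans (f-∧ a w)
    (trans (cong (f a ∧_) e) (trans (sym (f-∧ a (a ∨ₜ b))) (f-cong _ _ ∧-absorb))))))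
    (∧-left₂ (⊢-refl w))

  greatest-⊢ : ∀ {a b w} → Greatest a → f w ≡ f (a ∧ₜ b) → w ⊢ a
  greatest-⊢ {a} {b} {w} a-greatest e = ⊢-trans (∨-right₂ (⊢-refl w))
    (≤F⇒⊢ (a-greatest (a ∨ₜ w) (trans (f-∨ a w)
      (trans (cong (f a ∨_) e) (trans (sym (f-∨ a (a ∧ₜ b))) (f-cong _ _ ∨-absorb))))))

  -- Two joins of least preimages with equal images are thus equivalent, which lifts an equation
  -- between joins to the free lattice.
  join-least-⊢ : ∀ {a b c} → Least a → Least b → f c ≡ f (a ∨ₜ b) → a ∨ₜ b ⊢ c
  join-least-⊢ la lb e = ∨-left (least-⊢ la e) (least-⊢ lb (trans e (f-cong _ _ ∨-comm)))

  meet-greatest-⊢ : ∀ {a b c} → Greatest a → Greatest b → f c ≡ f (a ∧ₜ b) → c ⊢ a ∧ₜ b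
  meet-greatest-⊢ ga gb e =
    ∧-right (greatest-⊢ ga e) (greatest-⊢ gb (trans e (f-cong _ _ ∧-comm)))

  sd∨ : ∀ x y z → IsRegularClosed C x → IsRegularClosed C y → IsRegularClosed C z →
    x ∨ z ≡ y ∨ z → x ∨ z ≡ (x ∧ y) ∨ z
  sd∨ x y z rx ry rz e with least x rx | least y ry | least z rz
  ... | a , refl , la | b , refl , lb | c , refl , lc =
    trans (sym (f-∨ a c)) (trans (f-cong _ _ a∨c≈) (trans (f-∨ (a ∧ₜ b) c) (cong (_∨ f c) (f-∧ a b))))
    where
    e′ : f (a ∨ₜ c) ≡ f (b ∨ₜ c)
    e′ = trans (f-∨ a c) (trans e (sym (f-∨ b c)))
    a∨c≈ : (a ∨ₜ c) ≈F ((a ∧ₜ b) ∨ₜ c)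
    a∨c≈ = ⊢-antisym
      (⊢-semidistributive-∨ (join-least-⊢ la lc (sym e′)) (join-least-⊢ lb lc e′))
      (∨-left (∧-left₁ (∨-right₁ (⊢-refl a))) (∨-right₂ (⊢-refl c)))

  sd∧ : ∀ x y z → IsRegularClosed C x → IsRegularClosed C y → IsRegularClosed C z →
    x ∧ z ≡ y ∧ z → x ∧ z ≡ (x ∨ y) ∧ z
  sd∧ x y z rx ry rz e with greatest x rx | greatest y ry | greatest z rz
  ... | a , refl , ga | b , refl , gb | c , refl , gc =
    trans (sym (f-∧ a c)) (trans (f-cong _ _ a∧c≈) (trans (f-∧ (a ∨ₜ b) c) (cong (_∧ f c) (f-∨ a b))))
    where
    e′ : f (a ∧ₜ c) ≡ f (b ∧ₜ c)
    e′ = trans (f-∧ a c) (trans e (sym (f-∧ b c)))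
    a∧c≈ : (a ∧ₜ c) ≈F ((a ∨ₜ b) ∧ₜ c)
    a∧c≈ = ⊢-antisym
      (∧-right (∧-left₁ (∨-right₁ (⊢-refl a))) (∧-left₂ (⊢-refl c)))
      (⊢-semidistributive-∧ (meet-greatest-⊢ gb gc e′) (meet-greatest-⊢ ga gc (sym e′)))

-- Finite subsets

module _ {n : ℕ} where

  _≟ˢ_ : (x y : Subset n) → Dec (x ≡ y)
  _≟ˢ_ = ≡-dec Bool._≟_

  allSubset? : {P : Subset n → Set} → (∀ x → Dec (P x)) → Dec (∀ x → P x)
  allSubset? P? with anySubset? (λ x → ¬? (P? x))
  ... | yes (x , ¬Px) = no λ all → ¬Px (all x)
  ... | no ¬∃         = yes λ x → decidable-stable (P? x) λ ¬Px → ¬∃ (x , ¬Px)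

  module _ {P : Fin n → Set} (P? : ∀ i → Dec (P i)) where

    select : Subset n
    select = tabulate (does ∘ P?)

    ∈-select⁺ : ∀ {i} → P i → i ∈ select
    ∈-select⁺ {i} p = lookup⇒[]= i select (trans (lookup∘tabulate (does ∘ P?) i) (dec-true (P? i) p))

    ∈-select⁻ : ∀ {i} → i ∈ select → P i
    ∈-select⁻ {i} i∈ with P? i | trans (sym (lookup∘tabulate (does ∘ P?) i)) ([]=⇒lookup i∈)
    ... | yes p | _  = p
    ... | no _  | ()

  minimal-below : {P : Subset n → Set} → (∀ x → Dec (P x)) → ∀ x → P x →
    Σ[ y ∈ Subset n ] y ⊆ x × P y × (∀ z → z ⊆ y → P z → z ≡ y)
  minimal-below {P} P? x = go x (⊂-wellFounded x)
    where
    go : ∀ x → Acc _⊂_ x → P x →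
      Σ[ y ∈ Subset n ] y ⊆ x × P y × (∀ z → z ⊆ y → P z → z ≡ y)
    go x (acc rec) Px with anySubset? (λ z → (z ⊂? x) ×-dec P? z)
    ... | yes (z , z⊂x , Pz) =
      let y , y⊆z , rest = go z (rec z⊂x) Pz in y , (λ i∈y → proj₁ z⊂x (y⊆z i∈y)) , rest
    ... | no ¬∃ = x , id , Px , λ z z⊆x Pz →
      ⊆-antisym z⊆x λ {i} i∈x → decidable-stable (i ∈? z)
        λ i∉z → ¬∃ (z , ((λ {_} → z⊆x) , i , i∈x , i∉z) , Pz)

-- Regular closed subsets

module _ {n : ℕ} (C : ClosureOperator n) where
  open ClosureOperator C

  private
    int : Subset n → Subset n
    int = interior C

    Regular : Subset n → Set
    Regular = IsRegularClosed C

    _∨_ _∧_ : Subset n → Subset n → Subset n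
    _∨_ = _∨R_ C
    _∧_ = _∧R_ C

  Closed Open : Subset n → Set
  Closed x = φ x ⊆ x
  Open x = φ (∁ x) ⊆ ∁ x

  φ-closed : ∀ x → Closed (φ x)
  φ-closed x {i} = subst (i ∈_) (idempotent x)

  φ-least : ∀ {x y} → Closed y → x ⊆ y → φ x ⊆ y
  φ-least {x} {y} cy x⊆y i∈ = cy (isotone x y x⊆y i∈)

  φ-absorb : ∀ {x y} → x ⊆ φ y → φ x ⊆ φ y
  φ-absorb {x} {y} = φ-least {x} {φ y} (φ-closed y)

  interior-⊆ : ∀ x → int x ⊆ x
  interior-⊆ x i∈ = x∉∁p⇒x∈p (λ i∈∁ → x∈∁p⇒x∉p i∈ (extensive (∁ x) i∈∁))

  open-⊆-interior : ∀ {u x} → Open u → u ⊆ x → u ⊆ int x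
  open-⊆-interior {u} {x} ou u⊆x i∈u =
    x∉p⇒x∈∁p λ i∈ → x∈∁p⇒x∉p (ou (isotone (∁ x) (∁ u) (p⊆q⇒∁p⊇∁q u⊆x) i∈)) i∈u

  interior-open : ∀ x → Open (int x)
  interior-open x {i} i∈ = x∉p⇒x∈∁p λ i∈int → x∈∁p⇒x∉p i∈int
    (φ-absorb {∁ (int x)} {∁ x} (λ j∈ → x∉∁p⇒x∈p (x∈∁p⇒x∉p j∈)) i∈)

  interior-mono : ∀ {x y} → x ⊆ y → int x ⊆ int y
  interior-mono {x} x⊆y = open-⊆-interior (interior-open x) (λ i∈ → x⊆y (interior-⊆ x i∈))

  φ∘int-mono : ∀ {x y} → x ⊆ y → φ (int x) ⊆ φ (int y)
  φ∘int-mono x⊆y = isotone _ _ (interior-mono x⊆y)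

  regular-closed : ∀ {x} → Regular x → Closed x
  regular-closed {x} r {i} i∈ = subst (i ∈_) (sym r) (φ-closed (int x) (subst (λ y → i ∈ φ y) r i∈))

  regular-intro : ∀ {x} → Closed x → x ⊆ φ (int x) → Regular x
  regular-intro {x} cx x⊆ = ⊆-antisym x⊆ (φ-least cx (interior-⊆ x))

  regular-⊆ : ∀ {x} → Regular x → x ⊆ φ (int x)
  regular-⊆ r {i} = subst (i ∈_) r

  φ-open-regular : ∀ {u} → Open u → Regular (φ u)
  φ-open-regular {u} ou =
    regular-intro (φ-closed u) (isotone u _ (open-⊆-interior ou (extensive u)))

  ∅-regular : Regular ∅
  ∅-regular = regular-intro (λ {i} → subst (i ∈_) φ-empty) (λ i∈ → contradiction i∈ ∉⊥)

  ∨-upper₁ : ∀ x y → x ⊆ x ∨ y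
  ∨-upper₁ x y i∈ = extensive (x ∪ y) (x∈p∪q⁺ (inj₁ i∈))

  ∨-upper₂ : ∀ x y → y ⊆ x ∨ y
  ∨-upper₂ x y i∈ = extensive (x ∪ y) (x∈p∪q⁺ (inj₂ i∈))

  ∪-least : ∀ {x y z : Subset n} → x ⊆ z → y ⊆ z → x ∪ y ⊆ z
  ∪-least {x} {y} x⊆z y⊆z i∈ = [ x⊆z , y⊆z ]′ (x∈p∪q⁻ x y i∈)

  ∨-least : ∀ {x y z} → Closed z → x ⊆ z → y ⊆ z → x ∨ y ⊆ z
  ∨-least cz x⊆z y⊆z = φ-least cz (∪-least x⊆z y⊆z)

  ∨-regular : ∀ {x y} → Regular x → Regular y → Regular (x ∨ y)
  ∨-regular {x} {y} rx ry = regular-intro (φ-closed (x ∪ y)) (φ-absorb (∪-least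
    (λ i∈ → φ∘int-mono (∨-upper₁ x y) (regular-⊆ rx i∈))
    (λ i∈ → φ∘int-mono (∨-upper₂ x y) (regular-⊆ ry i∈))))

  ∧-regular : ∀ x y → Regular (x ∧ y)
  ∧-regular x y = φ-open-regular (interior-open (x ∩ y))

  ∧-lower₁ : ∀ {x y} → Closed x → x ∧ y ⊆ x
  ∧-lower₁ {x} {y} cx = φ-least cx (λ i∈ → p∩q⊆p x y (interior-⊆ (x ∩ y) i∈))

  ∧-lower₂ : ∀ {x y} → Closed y → x ∧ y ⊆ y
  ∧-lower₂ {x} {y} cy = φ-least cy (λ i∈ → p∩q⊆q x y (interior-⊆ (x ∩ y) i∈))

  ∧-greatest : ∀ {x y z} → Regular z → z ⊆ x → z ⊆ y → z ⊆ x ∧ y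
  ∧-greatest rz z⊆x z⊆y i∈ = φ∘int-mono (λ j∈ → x∈p∩q⁺ (z⊆x j∈ , z⊆y j∈)) (regular-⊆ rz i∈)

  -- Orthocomplementation of regular closed sets.

  _⊥ : Subset n → Subset n
  x ⊥ = φ (∁ x)

  ⊥-antitone : ∀ {x y} → x ⊆ y → y ⊥ ⊆ x ⊥
  ⊥-antitone x⊆y = isotone _ _ (p⊆q⇒∁p⊇∁q x⊆y)

  ⊥-involutive : ∀ {x} → Regular x → (x ⊥) ⊥ ≡ x
  ⊥-involutive r = sym r

  ⊥-regular : ∀ {x} → Regular x → Regular (x ⊥)
  ⊥-regular r = sym (cong _⊥ (⊥-involutive r))

  ⊥-∨ : ∀ {x y} → Regular x → Regular y → (x ∨ y) ⊥ ≡ (x ⊥) ∧ (y ⊥)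
  ⊥-∨ {x} {y} rx ry = ⊆-antisym
    (∧-greatest (⊥-regular (∨-regular rx ry)) (⊥-antitone (∨-upper₁ x y)) (⊥-antitone (∨-upper₂ x y)))
    -- From `m ⊆ x ⊥` follows `x ⊆ m ⊥`, and likewise for `y`; hence `x ∨ y ⊆ m ⊥`, and
    -- complementing once more gives the inclusion.
    (subst (_⊆ (x ∨ y) ⊥) (⊥-involutive rm) (⊥-antitone (∨-least (φ-closed _)
      (subst (_⊆ m ⊥) (⊥-involutive rx) (⊥-antitone (∧-lower₁ (φ-closed (∁ x)))))
      (subst (_⊆ m ⊥) (⊥-involutive ry) (⊥-antitone (∧-lower₂ (φ-closed (∁ y))))))))
    where
    m = (x ⊥) ∧ (y ⊥)
    rm = ∧-regular (x ⊥) (y ⊥)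

  ⊥-∧ : ∀ {x y} → Regular x → Regular y → (x ∧ y) ⊥ ≡ (x ⊥) ∨ (y ⊥)
  ⊥-∧ {x} {y} rx ry = trans (cong _⊥ (trans
      (sym (cong₂ _∧_ (⊥-involutive rx) (⊥-involutive ry)))
      (sym (⊥-∨ (⊥-regular rx) (⊥-regular ry)))))
    (⊥-involutive (∨-regular (⊥-regular rx) (⊥-regular ry)))

  -- The semilattice order of the hypothesis need not be decidable. The least
  -- preorder with the same join property is, and it is still antisymmetric.

  Saturated : Subset n → Set
  Saturated s = Closed s × (∀ p x → p ∈ s → MinimalCovering C p x → x ⊆ s)

  infix 4 _⊑_
  -- Saturated sets are stable under intersection, so the principal down-sets here are the smallest
  -- saturated sets around single points.
  _⊑_ : Fin n → Fin n → Set
  q ⊑ p = ∀ s → Saturated s → p ∈ s → q ∈ s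

  minimalCovering? : ∀ p x → Dec (MinimalCovering C p x)
  minimalCovering? p x = (p ∈? φ x) ×-dec
    allSubset? (λ y → (y ⊆? x) →-dec ((p ∈? φ y) →-dec (y ≟ˢ x)))

  saturated? : ∀ s → Dec (Saturated s)
  saturated? s = (φ s ⊆? s) ×-dec
    all? (λ p → allSubset? λ x → (p ∈? s) →-dec (minimalCovering? p x →-dec (x ⊆? s)))

  _⊑?_ : ∀ q p → Dec (q ⊑ p)
  q ⊑? p = allSubset? (λ s → saturated? s →-dec ((p ∈? s) →-dec (q ∈? s)))

  minimalCovering-below : ∀ {p} x → p ∈ φ x → Σ[ y ∈ Subset n ] y ⊆ x × MinimalCovering C p y
  minimalCovering-below {p} = minimal-below (λ y → p ∈? φ y)

  module _ (semilattice : SemilatticeType C) where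

    private
      _≤_ = proj₁ semilattice
      covering-join = proj₂ (proj₂ semilattice)
      module ≤ = IsPartialOrder (proj₁ (proj₂ semilattice))

    -- A join of points below `p` is below `p`, which gives closedness; members of a minimal
    -- covering lie below their join, which gives the second condition.
    ↓-saturated : ∀ {p} (≤p? : ∀ q → Dec (q ≤ p)) → Saturated (select ≤p?)
    ↓-saturated {p} ≤p? = closed , covered
      where
      closed : Closed (select ≤p?)
      closed {r} r∈ =
        let z , z⊆ , cov = minimalCovering-below (select ≤p?) r∈
        in ∈-select⁺ ≤p? (proj₂ (covering-join r z cov) p λ q q∈z → ∈-select⁻ ≤p? (z⊆ q∈z))
      covered : ∀ r x → r ∈ select ≤p? → MinimalCovering C r x → x ⊆ select ≤p?
      covered r x r∈ cov {q} q∈x =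
        ∈-select⁺ ≤p? (≤.trans (proj₁ (covering-join r x cov) q q∈x) (∈-select⁻ ≤p? r∈))

    -- Finitely many instances of excluded middle are jointly irrefutable, so under a double
    -- negation the down-set of `p` for `_≤_` exists as a subset. Since equality in `Fin n` is
    -- decidable, this weak form still yields antisymmetry.
    ⊑⇒¬¬≤ : ∀ {q p} → q ⊑ p → ¬ ¬ (q ≤ p)
    ⊑⇒¬¬≤ {q} {p} q⊑p q≰p =
      sequence (RawMonad.rawApplicative ¬¬-Monad) (λ r → ¬¬-excluded-middle {A = r ≤ p}) λ ≤p? →
        q≰p (∈-select⁻ ≤p? (q⊑p (select ≤p?) (↓-saturated ≤p?) (∈-select⁺ ≤p? ≤.refl)))

    ⊑-isPartialOrder : IsPartialOrder _≡_ _⊑_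
    ⊑-isPartialOrder = record
      { isPreorder = record
        { isEquivalence = isEquivalence
        ; reflexive     = λ { refl s _ p∈s → p∈s }
        ; trans         = λ q⊑p p⊑r s sat r∈s → q⊑p s sat (p⊑r s sat r∈s)
        }
      ; antisym = λ {q} {p} q⊑p p⊑q → decidable-stable (q ≟ p) λ q≢p →
          ⊑⇒¬¬≤ q⊑p λ q≤p → ⊑⇒¬¬≤ p⊑q λ p≤q → q≢p (≤.antisym q≤p p≤q)
      }

  -- Down-sets and locality of the closure.

  ↓ : Fin n → Subset n
  ↓ p = select (_⊑? p)

  _⊏?_ : ∀ q p → Dec (q ⊑ p × q ≢ p)
  q ⊏? p = (q ⊑? p) ×-dec ¬? (q ≟ p)

  ⇓ : Fin n → Subset n
  ⇓ p = select (_⊏? p)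

  ↓-trans : ∀ {p q r} → p ∈ ↓ q → q ∈ ↓ r → p ∈ ↓ r
  ↓-trans {p} {q} {r} p∈ q∈ = ∈-select⁺ (_⊑? r) λ s sat r∈s →
    ∈-select⁻ (_⊑? q) p∈ s sat (∈-select⁻ (_⊑? r) q∈ s sat r∈s)

  ∈-⇓⁺ : ∀ {p q} → q ∈ ↓ p → q ≢ p → q ∈ ⇓ p
  ∈-⇓⁺ {p} q∈ q≢p = ∈-select⁺ (_⊏? p) (∈-select⁻ (_⊑? p) q∈ , q≢p)

  ⇓-down : IsPartialOrder _≡_ _⊑_ → ∀ {p q r} → q ∈ ↓ r → r ∈ ⇓ p → q ∈ ⇓ p
  ⇓-down po {p} {q} {r} q∈ r∈ =
    let q⊑r = ∈-select⁻ (_⊑? r) q∈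
        r⊑p , r≢p = ∈-select⁻ (_⊏? p) r∈
    in ∈-select⁺ (_⊏? p) (Po.trans q⊑r r⊑p , λ { refl → r≢p (Po.antisym r⊑p q⊑r) })
    where module Po = IsPartialOrder po

  ↓-closed : ∀ p → Closed (↓ p)
  ↓-closed p {q} q∈ = ∈-select⁺ (_⊑? p) λ s sat p∈s →
    φ-least (proj₁ sat) (λ r∈ → ∈-select⁻ (_⊑? p) r∈ s sat p∈s) q∈

  -- A minimal covering of `p` inside `x` consists of points below `p`, because saturated sets
  -- absorb the minimal coverings of their points.
  φ-local : ∀ {p} x → p ∈ φ x → p ∈ φ (x ∩ ↓ p)
  φ-local {p} x p∈ =
    let z , z⊆x , cov = minimalCovering-below x p∈
    in isotone z (x ∩ ↓ p)
         (λ q∈z → x∈p∩q⁺ (z⊆x q∈z , ∈-select⁺ (_⊑? p) λ s sat p∈s → proj₂ sat p z p∈s cov q∈z))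
         (proj₁ cov)

  -- If the complement covered a point `r` of the intersection, it would do so inside `↓ r` by
  -- locality. There it agrees with the complement of `int x`, which is closed and misses `r`.
  interior∩↓-open : ∀ x p → Open (int x ∩ ↓ p)
  interior∩↓-open x p {r} r∈ = x∉p⇒x∈∁p λ r∈w →
    let r∈int , r∈↓p = x∈p∩q⁻ (int x) (↓ p) r∈w
        w = int x ∩ ↓ p
    in x∈∁p⇒x∉p (interior-open x (isotone (∁ w ∩ ↓ r) (∁ (int x))
         (λ q∈ → let q∈∁w , q∈↓r = x∈p∩q⁻ (∁ w) (↓ r) q∈ in
           x∉p⇒x∈∁p λ q∈int → x∈∁p⇒x∉p q∈∁w (x∈p∩q⁺ (q∈int , ↓-trans q∈↓r r∈↓p)))
         (φ-local (∁ w) r∈))) r∈int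

  -- The minimal regular closed sets around p play the part of the join-irreducible elements.
  record MinimalRegular (p : Fin n) (a : Subset n) : Set where
    field
      regular   : Regular a
      contains  : p ∈ a
      minimal   : ∀ b → b ⊆ a → Regular b → p ∈ b → b ≡ a

    -- The closure of `int a ∩ ↓ p` is regular, lies inside `a`, and contains `p` by locality, so
    -- minimality identifies it with `a`.
    bounded : a ⊆ ↓ p
    bounded = subst (_⊆ ↓ p)
      (minimal (φ w) (φ-least (regular-closed regular) λ i∈ → interior-⊆ a (p∩q⊆p (int a) (↓ p) i∈))
        (φ-open-regular (interior∩↓-open a p))
        (φ-local (int a) (regular-⊆ regular contains)))
      (φ-least (↓-closed p) (p∩q⊆q (int a) (↓ p)))
      where w = int a ∩ ↓ p

  minimalRegular-below : ∀ {p x} → Regular x → p ∈ x →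
    Σ[ a ∈ Subset n ] a ⊆ x × MinimalRegular p a
  minimalRegular-below {p} {x} rx p∈x =
    let a , a⊆x , (ra , p∈a) , min =
          minimal-below (λ y → (y ≟ˢ φ (int y)) ×-dec (p ∈? y)) x (rx , p∈x)
    in a , a⊆x , record
         { regular = ra ; contains = p∈a ; minimal = λ b b⊆a rb p∈b → min b b⊆a (rb , p∈b) }

  module _ (po : IsPartialOrder _≡_ _⊑_) (sd : RegSemidistributive C)
           {p : Fin n} {a : Subset n} (A : MinimalRegular p a) where
    open MinimalRegular A

    strictPart : Subset n → Subset n → Subset n
    strictPart x y = φ ((x ∪ y) ∩ ⇓ p)

    -- A point `r` of `x` or `y` strictly below `p` has a minimal regular closed set around it
    -- inside that same set; this set lies below `r`, hence strictly below `p`, hence inside `e`.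
    strictPart-regular : ∀ {x y} → Regular x → Regular y → Regular (strictPart x y)
    strictPart-regular {x} {y} rx ry = regular-intro (φ-closed e) (φ-absorb λ r∈e →
        let r∈x∪y , r∈⇓p = x∈p∩q⁻ (x ∪ y) (⇓ p) r∈e
        in [ (λ r∈x → covered rx (λ i∈ → x∈p∪q⁺ (inj₁ i∈)) r∈x r∈⇓p)
           , (λ r∈y → covered ry (λ i∈ → x∈p∪q⁺ (inj₂ i∈)) r∈y r∈⇓p) ]′ (x∈p∪q⁻ x y r∈x∪y))
      where
      e = (x ∪ y) ∩ ⇓ p
      covered : ∀ {z r} → Regular z → z ⊆ x ∪ y → r ∈ z → r ∈ ⇓ p → r ∈ φ (int (φ e))
      covered {z} {r} rz z⊆ r∈z r∈⇓p =
        let b , b⊆z , B = minimalRegular-below rz r∈z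
            module B = MinimalRegular B
        in φ∘int-mono (λ i∈b → extensive e (x∈p∩q⁺ (z⊆ (b⊆z i∈b) , ⇓-down po (B.bounded i∈b) r∈⇓p)))
             (regular-⊆ B.regular B.contains)

    -- If d is a minimal regular closed set around p inside x or y, then a and d have the same
    -- join with k := strictPart x y, whereas a ∧ d ≤ k unless a ∧ d = a; now apply
    -- join-semidistributivity.
    minimal-join-dichotomy : ∀ {x y} → Regular x → Regular y → a ⊆ x ∨ y →
      (a ⊆ x ⊎ a ⊆ y) ⊎ a ⊆ strictPart x y
    minimal-join-dichotomy {x} {y} rx ry a⊆ with p ∈? (x ∪ y)
    -- Points of `a` lie below `p`, so their local coverings from `x ∪ y`, which avoid `p`, lie
    -- strictly below `p`.
    ... | no p∉ = inj₂ a⊆k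
      where
      a⊆k : a ⊆ strictPart x y
      a⊆k {r} r∈a = isotone _ _
        (λ q∈ → let q∈x∪y , q∈↓r = x∈p∩q⁻ (x ∪ y) (↓ r) q∈ in
          x∈p∩q⁺ (q∈x∪y , ∈-⇓⁺ (↓-trans q∈↓r (bounded r∈a)) λ { refl → p∉ q∈x∪y }))
        (φ-local (x ∪ y) (a⊆ r∈a))
    ... | yes p∈ = [ (λ p∈x → map-left inj₁ (compare rx (λ i∈ → x∈p∪q⁺ (inj₁ i∈)) p∈x))
                   , (λ p∈y → map-left inj₂ (compare ry (λ i∈ → x∈p∪q⁺ (inj₂ i∈)) p∈y)) ]′
                   (x∈p∪q⁻ x y p∈)
      where
      k = strictPart x y
      e = (x ∪ y) ∩ ⇓ p
      rk : Regular k
      rk = strictPart-regular rx ry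

      a-strict⊆k : ∀ {r} → r ∈ a → r ≢ p → r ∈ k
      a-strict⊆k {r} r∈a r≢p = isotone _ _
        (λ q∈ → let q∈x∪y , q∈↓r = x∈p∩q⁻ (x ∪ y) (↓ r) q∈ in
          x∈p∩q⁺ (q∈x∪y , ⇓-down po q∈↓r (∈-⇓⁺ (bounded r∈a) r≢p)))
        (φ-local (x ∪ y) (a⊆ r∈a))

      compare : ∀ {z} → Regular z → z ⊆ x ∪ y → p ∈ z → a ⊆ z ⊎ a ⊆ k
      compare {z} rz z⊆ p∈z with minimalRegular-below rz p∈z
      ... | d , d⊆z , D with p ∈? (a ∧ d)
      -- Minimality of `a` forces `a ∧ d ≡ a`, so `a ⊆ d ⊆ z`.
      ... | yes p∈a∧d = inj₁ λ i∈a → d⊆z (∧-lower₂ (regular-closed D.regular)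
              (subst (_ ∈_) (sym a∧d≡a) i∈a))
        where
        module D = MinimalRegular D
        a∧d≡a : a ∧ d ≡ a
        a∧d≡a = minimal (a ∧ d) (∧-lower₁ (regular-closed regular)) (∧-regular a d) p∈a∧d
      ... | no p∉a∧d = inj₂ λ i∈a →
              a∧d∨k⊆k (subst (_ ∈_) (sd₁ a d k regular D.regular rk a∨k≡d∨k) (∨-upper₁ a k i∈a))
        where
        module D = MinimalRegular D
        sd₁ = proj₁ sd
        -- Both `a` and `d` lie in `k` except for the point `p`, which each of them can supply to
        -- the other's join with `k`.
        insert-p : ∀ {u v r} → (∀ {i} → i ∈ u → i ≢ p → i ∈ k) → p ∈ v → r ∈ u → r ∈ v ∨ k
        insert-p {u} {v} {r} u⊆ p∈v r∈u with r ≟ p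
        ... | yes refl = ∨-upper₁ v k p∈v
        ... | no r≢p   = ∨-upper₂ v k (u⊆ r∈u r≢p)
        d-strict⊆k : ∀ {r} → r ∈ d → r ≢ p → r ∈ k
        d-strict⊆k r∈d r≢p = extensive e (x∈p∩q⁺ (z⊆ (d⊆z r∈d) , ∈-⇓⁺ (D.bounded r∈d) r≢p))
        a∨k≡d∨k : a ∨ k ≡ d ∨ k
        a∨k≡d∨k = ⊆-antisym
          (∨-least (φ-closed _) (insert-p a-strict⊆k D.contains) (∨-upper₂ d k))
          (∨-least (φ-closed _) (insert-p d-strict⊆k contains) (∨-upper₂ a k))
        a∧d∨k⊆k : (a ∧ d) ∨ k ⊆ k
        a∧d∨k⊆k = ∨-least (φ-closed e)
          (λ r∈ → a-strict⊆k (∧-lower₁ (regular-closed regular) r∈) λ { refl → p∉a∧d r∈ })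
          id

  -- The generator (false , k) stands for the regular closed set φ (int k) and
  -- (true , k) for its orthocomplement, so that flipping the Boolean dualizes terms.
  Generator : Set
  Generator = Bool × Subset n

  ⟦_⟧ : Term Generator → Subset n
  ⟦ var (false , k) ⟧ = φ (int k)
  ⟦ var (true , k) ⟧  = φ (int k) ⊥
  ⟦ s ∨ₜ t ⟧ = ⟦ s ⟧ ∨ ⟦ t ⟧
  ⟦ s ∧ₜ t ⟧ = ⟦ s ⟧ ∧ ⟦ t ⟧

  ⟦⟧-regular : ∀ t → Regular ⟦ t ⟧
  ⟦⟧-regular (var (false , k)) = φ-open-regular (interior-open k)
  ⟦⟧-regular (var (true , k))  = ⊥-regular (φ-open-regular (interior-open k))
  ⟦⟧-regular (s ∨ₜ t) = ∨-regular (⟦⟧-regular s) (⟦⟧-regular t)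
  ⟦⟧-regular (s ∧ₜ t) = ∧-regular ⟦ s ⟧ ⟦ t ⟧

  ⟦⟧-closed : ∀ t → Closed ⟦ t ⟧
  ⟦⟧-closed t = regular-closed (⟦⟧-regular t)

  ⟦⟧-mono : ∀ {s t} → s ⊢ t → ⟦ s ⟧ ⊆ ⟦ t ⟧
  ⟦⟧-mono ⊢-var = id
  ⟦⟧-mono {t = t} (∨-left p q) = ∨-least (⟦⟧-closed t) (⟦⟧-mono p) (⟦⟧-mono q)
  ⟦⟧-mono (∨-right₁ {a} {b} p) i∈ = ∨-upper₁ ⟦ a ⟧ ⟦ b ⟧ (⟦⟧-mono p i∈)
  ⟦⟧-mono (∨-right₂ {a} {b} p) i∈ = ∨-upper₂ ⟦ a ⟧ ⟦ b ⟧ (⟦⟧-mono p i∈)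
  ⟦⟧-mono (∧-left₁ {a} p) i∈ = ⟦⟧-mono p (∧-lower₁ (⟦⟧-closed a) i∈)
  ⟦⟧-mono (∧-left₂ {b = b} p) i∈ = ⟦⟧-mono p (∧-lower₂ (⟦⟧-closed b) i∈)
  ⟦⟧-mono {s} (∧-right p q) = ∧-greatest (⟦⟧-regular s) (⟦⟧-mono p) (⟦⟧-mono q)

  -- The congruence is translated into Whitman's order, whose rules are sound in the lattice of
  -- regular closed sets.
  ⟦⟧-cong : ∀ s t → s ≈F t → ⟦ s ⟧ ≡ ⟦ t ⟧
  ⟦⟧-cong _ _ e = ⊆-antisym (⟦⟧-mono (proj₁ (≈F⇒⊢ e))) (⟦⟧-mono (proj₂ (≈F⇒⊢ e)))

  open Dual {Generator} (map₁ not)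

  -- Complementation exchanges the two kinds of generators, and De Morgan's laws carry this through
  -- joins and meets.
  ⟦⟧-dual : ∀ t → ⟦ dual t ⟧ ≡ ⟦ t ⟧ ⊥
  ⟦⟧-dual (var (false , k)) = refl
  ⟦⟧-dual (var (true , k))  = sym (⊥-involutive (φ-open-regular (interior-open k)))
  ⟦⟧-dual (s ∨ₜ t) =
    trans (cong₂ _∧_ (⟦⟧-dual s) (⟦⟧-dual t)) (sym (⊥-∨ (⟦⟧-regular s) (⟦⟧-regular t)))
  ⟦⟧-dual (s ∧ₜ t) =
    trans (cong₂ _∨_ (⟦⟧-dual s) (⟦⟧-dual t)) (sym (⊥-∧ (⟦⟧-regular s) (⟦⟧-regular t)))

  -- Terms formed as meets over all subsets.

  ⋀ : ∀ {m} → (Subset m → Term Generator) → Term Generator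
  ⋀ {zero}  h = h []
  ⋀ {suc m} h = ⋀ (h ∘ (inside ∷_)) ∧ₜ ⋀ (h ∘ (outside ∷_))

  ⋀-lower : ∀ {m} (h : Subset m → Term Generator) k → ⋀ h ⊢ h k
  ⋀-lower h []            = ⊢-refl (h [])
  ⋀-lower h (inside ∷ k)  = ∧-left₁ (⋀-lower (h ∘ (inside ∷_)) k)
  ⋀-lower h (outside ∷ k) = ∧-left₂ (⋀-lower (h ∘ (outside ∷_)) k)

  ⋀-greatest : ∀ {m a} → Regular a → (h : Subset m → Term Generator) →
    (∀ k → a ⊆ ⟦ h k ⟧) → a ⊆ ⟦ ⋀ h ⟧
  ⋀-greatest {zero}  ra h a⊆ = a⊆ []
  ⋀-greatest {suc m} ra h a⊆ = ∧-greatest ra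
    (⋀-greatest ra (h ∘ (inside ∷_)) (λ k → a⊆ (inside ∷ k)))
    (⋀-greatest ra (h ∘ (outside ∷_)) (λ k → a⊆ (outside ∷ k)))

  -- Merges the bounds found for the various `k` into a single term that still lies above `a`.
  common-lower-term : ∀ {a} → Regular a → {Q : Subset n → Set} → (∀ k → Dec (Q k)) →
    (H : Subset n → Term Generator → Set) →
    (∀ k → Q k → Σ[ t ∈ Term Generator ] a ⊆ ⟦ t ⟧ × (∀ s → H k s → t ⊢ s)) →
    Σ[ t ∈ Term Generator ] a ⊆ ⟦ t ⟧ × (∀ k → Q k → ∀ s → H k s → t ⊢ s)
  common-lower-term {a} ra {Q} Q? H g =
    ⋀ (proj₁ ∘ term) , ⋀-greatest ra (proj₁ ∘ term) (proj₁ ∘ proj₂ ∘ term) ,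
    λ k Qk s Hks → ⊢-trans (⋀-lower (proj₁ ∘ term) k) (proj₂ (proj₂ (term k)) Qk s Hks)
    where
    term : ∀ k → Σ[ t ∈ Term Generator ] a ⊆ ⟦ t ⟧ × (Q k → ∀ s → H k s → t ⊢ s)
    term k with Q? k
    ... | yes Qk = let t , a⊆ , t⊢ = g k Qk in t , a⊆ , λ _ → t⊢
    -- Terms have no top element; the generator with value `a` serves as a neutral factor.
    ... | no ¬Qk = var (false , a) , regular-⊆ ra , λ Qk → contradiction Qk ¬Qk

  -- A meet of generators above `a`, formed separately for plain and complemented ones because
  -- `common-lower-term` ranges over subsets only.
  generator-bound : ∀ {a} → Regular a →
    Σ[ t ∈ Term Generator ] a ⊆ ⟦ t ⟧ × (∀ x → a ⊆ ⟦ var x ⟧ → t ⊢ var x)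
  generator-bound {a} ra =
    let t , a⊆t , t⊢ = bound false
        t′ , a⊆t′ , t′⊢ = bound true
    in t ∧ₜ t′ , ∧-greatest ra a⊆t a⊆t′ ,
       λ { (false , k) a⊆ → ∧-left₁ (t⊢ k a⊆ _ refl)
         ; (true , k)  a⊆ → ∧-left₂ (t′⊢ k a⊆ _ refl) }
    where
    bound : ∀ b → Σ[ t ∈ Term Generator ] a ⊆ ⟦ t ⟧ ×
      (∀ k → a ⊆ ⟦ var (b , k) ⟧ → ∀ s → s ≡ var (b , k) → t ⊢ s)
    bound b = common-lower-term ra (λ k → a ⊆? ⟦ var (b , k) ⟧) (λ k s → s ≡ var (b , k))
      λ k a⊆ → var (b , k) , a⊆ , λ { _ refl → ⊢-var }

  -- Leastness is demanded against every term whose value contains `a`, not only those of value `a`;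
  -- this form passes through joins and supports induction on `s`.
  LeastTerm : Subset n → Set
  LeastTerm a = Σ[ t ∈ Term Generator ] ⟦ t ⟧ ≡ a × (∀ s → a ⊆ ⟦ s ⟧ → t ⊢ s)

  -- The regular set `a` is the value of a generator, so leastness against that generator gives the
  -- missing inclusion.
  leastTerm-intro : ∀ {a} t → Regular a → a ⊆ ⟦ t ⟧ → (∀ s → a ⊆ ⟦ s ⟧ → t ⊢ s) → LeastTerm a
  leastTerm-intro {a} t ra a⊆t least = t , ⊆-antisym t⊆a a⊆t , least
    where
    t⊆a : ⟦ t ⟧ ⊆ a
    t⊆a i∈ = subst (_ ∈_) (sym ra) (⟦⟧-mono (least (var (false , a)) (regular-⊆ ra)) i∈)

  leastTerm-∅ : LeastTerm ∅
  leastTerm-∅ with generator-bound ∅-regular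
  ... | t , ∅⊆t , t⊢ = leastTerm-intro t ∅-regular ∅⊆t λ s _ → bottom s
    where
    -- Every generator contains `∅`, so `t` is below all generators and, inductively, below all
    -- terms.
    bottom : ∀ s → t ⊢ s
    bottom (var x)  = t⊢ x (⊆-min ⟦ var x ⟧)
    bottom (a ∨ₜ b) = ∨-right₁ (bottom a)
    bottom (a ∧ₜ b) = ∧-right (bottom a) (bottom b)

  leastTerm-∨ : ∀ {a b} → LeastTerm a → LeastTerm b → LeastTerm (a ∨ b)
  leastTerm-∨ {a} {b} (s , refl , s-least) (t , refl , t-least) = s ∨ₜ t , refl , λ u ⊆u →
    ∨-left (s-least u λ i∈ → ⊆u (∨-upper₁ a b i∈)) (t-least u λ i∈ → ⊆u (∨-upper₂ a b i∈))

  -- Joins minimal regular closed sets inside `x` around the points of `x ∩ y`; the result lies in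
  -- `x` and contains a generating set of it. The uses are `y = ⇓ p` in the recursion and `y = ⊤` at
  -- the end.
  leastTerm-generated : ∀ {x} y → Regular x → x ⊆ φ (x ∩ y) →
    (∀ r → r ∈ y → ∀ {a} → MinimalRegular r a → LeastTerm a) → LeastTerm x
  leastTerm-generated {x} y rx x⊆ leastTerm =
    let z , lt , z⊆x , ⊆z = join (allFin n)
        cz = subst Closed (proj₁ (proj₂ lt)) (⟦⟧-closed (proj₁ lt))
    in subst LeastTerm
         (⊆-antisym z⊆x λ i∈ → φ-least cz (λ {r} r∈ → ⊆z r (∈-allFin r) r∈) (x⊆ i∈)) lt
    where
    join : (rs : List (Fin n)) →
      Σ[ z ∈ Subset n ] LeastTerm z × z ⊆ x × (∀ r → r ∈ˡ rs → r ∈ x ∩ y → r ∈ z)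
    join [] = ∅ , leastTerm-∅ , ⊆-min x , λ _ ()
    join (r ∷ rs) with join rs | r ∈? (x ∩ y)
    ... | z , lt , z⊆x , ⊆z | no r∉ = z , lt , z⊆x ,
      λ { _ (here refl) r∈ → contradiction r∈ r∉ ; q (there q∈) → ⊆z q q∈ }
    ... | z , lt , z⊆x , ⊆z | yes r∈ =
      let r∈x , r∈y = x∈p∩q⁻ x y r∈
          a , a⊆x , A = minimalRegular-below rx r∈x
      in a ∨ z , leastTerm-∨ (leastTerm r r∈y A) lt ,
         ∨-least (regular-closed rx) a⊆x z⊆x ,
         λ { _ (here refl) _ → ∨-upper₁ a z (MinimalRegular.contains A)
           ; q (there q∈) q∈xy → ∨-upper₂ a z (⊆z q q∈ q∈xy) }

  -- Least terms by recursion along the strict order.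

  module _ (po : IsPartialOrder _≡_ _⊑_) (sd : RegSemidistributive C) where

    _⊏_ : Fin n → Fin n → Set
    q ⊏ p = q ⊑ p × q ≢ p

    leastTerm-step : ∀ {p a} → (∀ {q b} → q ⊏ p → MinimalRegular q b → LeastTerm b) →
      MinimalRegular p a → LeastTerm a
    leastTerm-step {p} {a} ih A = combine (generator-bound regular) cover-bound
      where
      open MinimalRegular A

      -- Finitely many sets `k` stand in for the strict parts of infinitely many pairs of terms;
      -- being generated strictly below `p`, each has a least term by `ih`.
      Below : Subset n → Set
      Below k = Regular k × k ⊆ φ (k ∩ ⇓ p) × a ⊆ k

      below? : ∀ k → Dec (Below k)
      below? k = (k ≟ˢ φ (int k)) ×-dec ((k ⊆? φ (k ∩ ⇓ p)) ×-dec (a ⊆? k))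

      leastTerm-below : ∀ k → Below k →
        Σ[ t ∈ Term Generator ] a ⊆ ⟦ t ⟧ × (∀ s → k ⊆ ⟦ s ⟧ → t ⊢ s)
      leastTerm-below k (rk , k⊆ , a⊆k)
        with leastTerm-generated (⇓ p) rk k⊆ (λ r r∈ → ih (∈-select⁻ (_⊏? p) r∈))
      ... | t , t≡k , t-least = t , (λ i∈a → subst (_ ∈_) (sym t≡k) (a⊆k i∈a)) , t-least

      cover-bound : Σ[ t ∈ Term Generator ] a ⊆ ⟦ t ⟧ ×
        (∀ k → Below k → ∀ s → k ⊆ ⟦ s ⟧ → t ⊢ s)
      cover-bound = common-lower-term regular below? (λ k s → k ⊆ ⟦ s ⟧) leastTerm-below

      combine : Σ[ t ∈ Term Generator ] a ⊆ ⟦ t ⟧ × (∀ x → a ⊆ ⟦ var x ⟧ → t ⊢ var x) →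
        Σ[ t ∈ Term Generator ] a ⊆ ⟦ t ⟧ × (∀ k → Below k → ∀ s → k ⊆ ⟦ s ⟧ → t ⊢ s) →
        LeastTerm a
      combine (t , a⊆t , t⊢) (t′ , a⊆t′ , t′⊢) =
        leastTerm-intro (t ∧ₜ t′) regular (∧-greatest regular a⊆t a⊆t′) least
        where
        least : ∀ s → a ⊆ ⟦ s ⟧ → t ∧ₜ t′ ⊢ s
        least (var x) a⊆ = ∧-left₁ (t⊢ x a⊆)
        least (u ∧ₜ v) a⊆ =
          ∧-right (least u λ i∈ → ∧-lower₁ (⟦⟧-closed u) (a⊆ i∈))
                  (least v λ i∈ → ∧-lower₂ (⟦⟧-closed v) (a⊆ i∈))
        least (u ∨ₜ v) a⊆
          with minimal-join-dichotomy po sd A (⟦⟧-regular u) (⟦⟧-regular v) a⊆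
        ... | inj₁ (inj₁ a⊆u) = ∨-right₁ (least u a⊆u)
        ... | inj₁ (inj₂ a⊆v) = ∨-right₂ (least v a⊆v)
        -- The strict part `φ e` is one of the sets `k`, and it lies inside the value of `u ∨ₜ v`.
        ... | inj₂ a⊆k = ∧-left₂ (t′⊢ (φ e) (re , e⊆ , a⊆k) (u ∨ₜ v)
            (isotone e w (p∩q⊆p w (⇓ p))))
          where
          w = ⟦ u ⟧ ∪ ⟦ v ⟧
          e = w ∩ ⇓ p
          re : Regular (φ e)
          re = strictPart-regular po sd A (⟦⟧-regular u) (⟦⟧-regular v)
          e⊆ : φ e ⊆ φ (φ e ∩ ⇓ p)
          e⊆ = isotone e (φ e ∩ ⇓ p) (λ i∈ → x∈p∩q⁺ (extensive e i∈ , p∩q⊆q w (⇓ p) i∈))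

    leastTerm-minimal : ∀ {p a} → Acc _⊏_ p → MinimalRegular p a → LeastTerm a
    leastTerm-minimal (acc rec) A = leastTerm-step (λ q⊏p B → leastTerm-minimal (rec q⊏p) B) A

    leastTerm-regular : ∀ {x} → Regular x → LeastTerm x
    leastTerm-regular {x} rx = leastTerm-generated ⊤ rx
      (λ i∈ → extensive (x ∩ ⊤) (x∈p∩q⁺ (i∈ , ∈⊤)))
      (λ r _ → leastTerm-minimal (po-wellFounded po r))

    semidistributive⇒bounded : RegBoundedHomImageOfFree C
    semidistributive⇒bounded =
      Generator , ⟦_⟧ , ⟦⟧-regular , ⟦⟧-cong , (λ _ _ → refl) , (λ _ _ → refl) ,
      (λ x rx → let t , e , _ = leastTerm-regular rx in t , e) ,
      (λ x rx → let t , e , least = leastTerm-regular rx in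
        t , e , λ s s≡x → ⊢⇒≤F (least s (⊆-reflexive (sym s≡x)))) ,
      -- The greatest preimage of `x` is the dual of the least term for `x ⊥`: a term of value `x`
      -- dualizes to one of value `x ⊥`, and dualizing back reverses the comparison.
      λ x rx → let t , e , least = leastTerm-regular (⊥-regular rx) in
        dual t , trans (⟦⟧-dual t) (trans (cong _⊥ e) (⊥-involutive rx)) ,
        λ s s≡x → ⊢⇒≤F (subst (_⊢ dual t) (dual-involutive flip-flip s)
          (dual-⊢ (least (dual s) (⊆-reflexive (sym (trans (⟦⟧-dual s) (cong _⊥ s≡x)))))))
      where
      flip-flip : ∀ x → map₁ not (map₁ not x) ≡ x
      flip-flip (b , k) = cong (_, k) (Bool.not-involutive b)

theorem10p4 : (n : ℕ) (C : ClosureOperator n) → SemilatticeType C →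
    RegSemidistributive C ⇔ RegBoundedHomImageOfFree C
theorem10p4 n C semilattice =
  mk⇔ (semidistributive⇒bounded C (⊑-isPartialOrder C semilattice)) (bounded⇒semidistributive C)
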